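{- For every integer $n\ge 1$, $|\mathcal{S}_n(23;\,1\to 2)| = B_n$, where $B_n$ is the $n$-th Bell number.
   Context: $[n]=\{1,\dots,n\}$, and $\mathcal{S}_n$ is the set of permutations $\pi=\pi_1\pi_2\cdots\pi_n$ of $[n]$ in one-line notation. The permutation $\hat\pi$: for $\pi\in\mathcal{S}_n$, $\hat\pi\in\mathcal{S}_n$ is the permutation whose cycle form is obtained from the word $\pi_1\cdots\pi_n$ by inserting a left parenthesis before each left-to-right maximum (an entry larger than all entries to its left) and a right parenthesis immediately before the next left-to-right maximum, or at the end of the word. A cycle $(c_1,c_2,\dots,c_s)$ means $c_1\mapsto c_2\mapsto\cdots\mapsto c_s\mapsto c_1$. Example: if $\pi=2537164$ then $\hat\pi=(2)(53)(7164)$. Arrow patterns: an arrow pattern of size $k$ is a pair $(\nu;H)$ where $\nu=\nu_1\cdots\nu_m$ is a word of distinct positive integers, $H$ is a collection of arrows $b_i\to c_i$, and the set of all integers appearing in $\nu$ or $H$ is $[k]$. A permutation $\pi\in\mathcal{S}_n$ contains $(\nu;H)$ if there are a set $X=\{x_1<x_2<\cdots<x_k\}\subseteq[n]$ and indices $t_1<\cdots<t_m$ such that $\pi_{t_1}\pi_{t_2}\cdots\pi_{t_m}=x_{\nu_1}x_{\nu_2}\cdots x_{\nu_m}$ and $\hat\pi(x_{b_i})=x_{c_i}$ for every arrow $b_i\to c_i$ in $H$. Otherwise $\pi$ avoids $(\nu;H)$. $\mathcal{S}_n(\nu;H)$ is the set of permutations in $\mathcal{S}_n$ avoiding $(\nu;H)$.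 The Bell number $B_n$ is the number of set partitions of $[n]$. -}

module Defs where

open import Data.Bool.Base using (if_then_else_)
open import Data.Fin.Base using (Fin; zero; suc; _<_)
open import Data.Fin using (#_)
open import Data.Fin.Properties using (_≟_; _<?_; any?; all?)
open import Data.Fin.Subset using (Subset; Nonempty; Empty; _∩_; inside; outside; _∈_)
open import Data.Fin.Subset.Properties using (nonempty?; _∈?_)
open import Data.List.Base
  using (List; []; _∷_; [_]; _++_; _∷ʳ_; map; zip; concatMap; filter; length; allFin; cartesianProductWith)
open import Data.List.Relation.Unary.All as All using (All)
open import Data.List.Relation.Unary.AllPairs as AllPairs using (AllPairs)
open import Data.List.Relation.Unary.Any as Any using (Any; here; there)
open import Data.Nat.Base using (ℕ; zero; suc)
open import Data.Product.Base using (∃; _×_; _,_)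
open import Data.Sum.Base using (_⊎_; inj₁; inj₂)
open import Data.Vec.Base as Vec using (Vec; []; _∷_; lookup; toList)
import Data.Vec.Membership.Propositional as VecMembership
import Data.Vec.Relation.Unary.AllPairs as VecAllPairs
import Data.Vec.Relation.Unary.All as VecAll
import Data.Vec.Relation.Unary.Any as VecAny
open import Data.Vec.Relation.Unary.Unique.Propositional using (Unique)
open import Relation.Binary.PropositionalEquality using (_≡_; refl)
open import Relation.Nullary using (Dec; does; ¬?; _×-dec_; map′)

-- Throughout, [n] is represented by Fin n, so every label is shifted down
-- by one; only the relative order of labels matters.

------------------------------------------------------------------------
-- Enumerations

vectors : {A : Set} → List A → (n : ℕ) → List (Vec A n)
vectors xs zero    = [ [] ]
vectors xs (suc n) = cartesianProductWith _∷_ xs (vectors xs n)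

-- Each set of positions of the list is used once, so for a list without
-- repetitions this enumerates the subsets of its set of entries.
sublists : {A : Set} → List A → List (List A)
sublists []       = [ [] ]
sublists (x ∷ xs) = map (x ∷_) (sublists xs) ++ sublists xs

anyVec? : ∀ {n k} {P : Vec (Fin n) k → Set} → (∀ v → Dec (P v)) → Dec (∃ P)
anyVec? {k = zero}  P? = map′ (λ p → [] , p) (λ { ([] , p) → p }) (P? [])
anyVec? {k = suc k} P? =
  map′ (λ { (i , v , p) → i ∷ v , p }) (λ { (i ∷ v , p) → i , v , p })
       (any? λ i → anyVec? λ v → P? (i ∷ v))

------------------------------------------------------------------------
-- Permutations in one-line notation

unique? : ∀ {n k} (w : Vec (Fin n) k) → Dec (Unique w)
unique? = VecAllPairs.allPairs? (λ x y → ¬? (x ≟ y))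

permutations : (n : ℕ) → List (Vec (Fin n) n)
permutations n = filter unique? (vectors (allFin n) n)

------------------------------------------------------------------------
-- The permutation π̂

-- cyclesFrom m c w : the cycles still to be closed, where c is the part of
-- the open cycle already read, m is the largest entry read so far, and w is
-- the rest of the word.
cyclesFrom : ∀ {n} → Fin n → List (Fin n) → List (Fin n) → List (List (Fin n))
cyclesFrom m c []      = [ c ]
cyclesFrom m c (y ∷ w) =
  if does (m <? y) then c ∷ cyclesFrom y [ y ] w
                   else cyclesFrom m (c ∷ʳ y) w

cycles : ∀ {n} → List (Fin n) → List (List (Fin n))
cycles []      = []
cycles (x ∷ w) = cyclesFrom x [ x ] w

cycleGraph : {A : Set} → List A → List (A × A)
cycleGraph []       = []
cycleGraph (c ∷ cs) = zip (c ∷ cs) (cs ∷ʳ c)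

evaluate : ∀ {n} → List (Fin n × Fin n) → Fin n → Fin n
evaluate []            x = x
evaluate ((a , b) ∷ g) x = if does (x ≟ a) then b else evaluate g x

hat : ∀ {n} → Vec (Fin n) n → Fin n → Fin n
hat π = evaluate (concatMap cycleGraph (cycles (toList π)))

-- 2537164 ↦ (2)(53)(7164)
_ : cycles {7} (# 1 ∷ # 4 ∷ # 2 ∷ # 6 ∷ # 0 ∷ # 5 ∷ # 3 ∷ [])
  ≡ (# 1 ∷ []) ∷ (# 4 ∷ # 2 ∷ []) ∷ (# 6 ∷ # 0 ∷ # 5 ∷ # 3 ∷ []) ∷ []
_ = refl

_ : Vec.tabulate (hat {7} (# 1 ∷ # 4 ∷ # 2 ∷ # 6 ∷ # 0 ∷ # 5 ∷ # 3 ∷ []))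
  ≡ # 5 ∷ # 1 ∷ # 4 ∷ # 6 ∷ # 2 ∷ # 3 ∷ # 0 ∷ []
_ = refl

------------------------------------------------------------------------
-- Arrow patterns

record ArrowPattern (k : ℕ) : Set where
  field
    {m}      : ℕ
    ν        : Vec (Fin k) m
    H        : List (Fin k × Fin k)
    distinct : Unique ν
    covers   : ∀ i → i VecMembership.∈ ν ⊎ Any (λ (b , c) → i ≡ b ⊎ i ≡ c) H

Increasing : ∀ {n k} → Vec (Fin n) k → Set
Increasing = VecAllPairs.AllPairs _<_

module _ {n k : ℕ} (π : Vec (Fin n) n) (p : ArrowPattern k) where
  open ArrowPattern p

  Occurrence : Vec (Fin n) k → Vec (Fin n) m → Set
  Occurrence x t =
      Increasing x
    × Increasing t
    × (∀ j → lookup π (lookup t j) ≡ lookup x (lookup ν j))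
    × All (λ (b , c) → hat π (lookup x b) ≡ lookup x c) H

  Contains : Set
  Contains = ∃ λ x → ∃ λ t → Occurrence x t

  contains? : Dec Contains
  contains? = anyVec? λ x → anyVec? λ t →
          VecAllPairs.allPairs? _<?_ x
    ×-dec VecAllPairs.allPairs? _<?_ t
    ×-dec all? (λ j → lookup π (lookup t j) ≟ lookup x (lookup ν j))
    ×-dec All.all? (λ (b , c) → hat π (lookup x b) ≟ lookup x c) H

avoiders : ∀ {k} (n : ℕ) → ArrowPattern k → List (Vec (Fin n) n)
avoiders n p = filter (λ π → ¬? (contains? π p)) (permutations n)

-- (23; 1 → 2)
pattern23-1→2 : ArrowPattern 3
pattern23-1→2 = record
  { ν        = # 1 ∷ # 2 ∷ []
  ; H        = [ (# 0 , # 1) ]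
  ; distinct = ((λ ()) VecAll.∷ VecAll.[]) VecAllPairs.∷ VecAll.[] VecAllPairs.∷ VecAllPairs.[]
  ; covers   = λ { zero             → inj₂ (here (inj₁ refl))
                 ; (suc zero)       → inj₁ (VecAny.here refl)
                 ; (suc (suc zero)) → inj₁ (VecAny.there (VecAny.here refl)) }
  }

------------------------------------------------------------------------
-- Set partitions and Bell numbers

Disjoint : ∀ {n} → Subset n → Subset n → Set
Disjoint p q = Empty (p ∩ q)

IsSetPartition : ∀ {n} → List (Subset n) → Set
IsSetPartition blocks =
    All Nonempty blocks
  × AllPairs Disjoint blocks
  × (∀ i → Any (i ∈_) blocks)

isSetPartition? : ∀ {n} (blocks : List (Subset n)) → Dec (IsSetPartition blocks)
isSetPartition? blocks =
        All.all? nonempty? blocks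
  ×-dec AllPairs.allPairs? (λ p q → ¬? (nonempty? (p ∩ q))) blocks
  ×-dec all? (λ i → Any.any? (i ∈?_) blocks)

-- A set of blocks is a sublist of the repetition-free list of all subsets
-- of [n], so each set partition is listed exactly once.
setPartitions : (n : ℕ) → List (List (Subset n))
setPartitions n =
  filter isSetPartition? (sublists (vectors (inside ∷ outside ∷ []) n))

bell : ℕ → ℕ
bell n = length (setPartitions n)

{-# OPTIONS --safe #-}

-- A permutation of [n] avoids (23; 1 → 2) exactly when it is a word a₁ < ⋯ < aᵣ < n
-- followed by a word in which the top of every adjacent ascent is at least every later
-- letter: a cycle of π̂ of length > 1 that is closed before n is reached contains an arrow
-- from its last letter up to its left-to-right maximum c, with n to the right of c.
-- For such a word let m i be the largest letter at or to the right of i.  Then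
-- i ≤ m i and m (m i) = m i, and the word is recovered from m by sorting [n]: the fibres
-- of m come in decreasing order of m, the fibre of n increasingly, and every other fibre
-- decreasingly except that its maximum comes last.  These functions m are the block
-- maximum functions of the set partitions of [n].
module Submission where

open import Data.Bool.Base using (true; false)
import Data.Bool.Properties as Bool using (_≟_)
open import Data.Fin.Base using (Fin; zero; suc; _<_; _≤_; fromℕ)
open import Data.Fin.Properties
  using (_≟_; _<?_; _≤?_; any?; all?; injective⇒≤; ≤-total; ≤-antisym; ≤∧≢⇒<; <⇒≢; ≤fromℕ; <-cmp)
open import Data.Fin.Subset using (Subset; Nonempty; inside; outside) renaming (_∈_ to _∈ˢ_)
open import Data.Fin.Subset.Properties
  using (⊆-antisym; x∈p∩q⁺; x∈p∩q⁻) renaming (_∈?_ to _∈ˢ?_)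
open import Data.List.Base
  using (List; []; _∷_; [_]; _++_; _∷ʳ_; map; zip; concat; concatMap; length; filter; allFin)
open import Data.List.Membership.Propositional using (_∈_; _∉_; find; lose)
open import Data.List.Membership.Propositional.Properties
  using ( ∈-allFin; ∈-map⁺; ∈-map⁻; ∈-++⁺ˡ; ∈-++⁺ʳ; ∈-++⁻; ∈-filter⁺; ∈-filter⁻
        ; ∈-cartesianProductWith⁺)
open import Data.List.Membership.Propositional.Properties.WithK using (unique∧set⇒bag)
open import Data.List.Properties as List using (length-tabulate; map-++; ++-assoc; ++-identityʳ)
open import Data.List.Relation.Binary.BagAndSetEquality using (∼bag⇒↭)
open import Data.List.Relation.Binary.Permutation.Propositional using (_↭_; ↭-sym; ↭⇒↭ₛ)
open import Data.List.Relation.Binary.Permutation.Propositional.Properties using (↭-length)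
import Data.List.Relation.Binary.Permutation.Setoid.Properties as Setoid↭
open import Data.List.Relation.Unary.All as All using (All; []; _∷_)
open import Data.List.Relation.Unary.AllPairs as AllPairs using (AllPairs; []; _∷_)
open import Data.List.Relation.Unary.Any as Any using (Any; here; there)
open import Data.List.Relation.Unary.Linked.Properties using (Linked⇒AllPairs)
open import Data.List.Relation.Unary.Unique.Propositional using (Unique)
open import Data.List.Relation.Unary.Unique.Propositional.Properties as Unique using (allFin⁺)
open import Data.Nat.Base using (ℕ; zero; suc; s≤s; z≤n; _≥_)
import Data.Nat.Properties as ℕ
open import Data.Product.Base using (∃; _×_; _,_; proj₁; proj₂)
open import Data.Sum.Base using (_⊎_; inj₁; inj₂)
open import Data.Vec.Base as Vec using (Vec; []; _∷_; toList)
open import Data.Vec.Functional using (updateAt)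
open import Data.Vec.Functional.Properties using (updateAt-updates; updateAt-minimal)
open import Data.Vec.Properties
  using ( ∷-injective; ≡-dec; lookup⇒[]=; []=⇒lookup; tabulate∘lookup; tabulate-cong
        ; lookup∘tabulate; toList∘fromList; toList-injective; cast-is-id)
open import Data.Vec.Relation.Unary.All using ([]; _∷_)
import Data.Vec.Relation.Unary.All.Properties as VecAll
open import Data.Vec.Relation.Unary.AllPairs using ([]; _∷_)
open import Data.Vec.Relation.Unary.Unique.Propositional using () renaming (Unique to VecUnique)
open import Data.Vec.Relation.Unary.Unique.Propositional.Properties using (lookup-injective)
open import Function.Base using (_∘_; const; id)
open import Function.Bundles using (mk⇔)
open import Level using (0ℓ)
open import Relation.Binary.Bundles using (DecTotalOrder)
import Relation.Binary.Construct.StrictToNonStrict as NonStrict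
open import Relation.Binary.Core using (Rel)
open import Relation.Binary.Definitions using (Asymmetric; Trichotomous; tri<; tri≈; tri>)
open import Relation.Binary.PropositionalEquality
  using (_≡_; _≢_; refl; sym; trans; cong; cong₂; subst; isEquivalence; resp₂; setoid)
open import Relation.Nullary using (Dec; ¬_; ¬?; yes; no; contradiction; _×-dec_)
open import Relation.Nullary.Decidable using (does; dec-true; dec-false)
open import Defs

-- Repetition-free lists and counting along a relation

private
  variable
    A B : Set
    n : ℕ

unique⇒∉ : ∀ {x : A} {xs} → Unique (x ∷ xs) → x ∉ xs
unique⇒∉ = Unique.Unique[x∷xs]⇒x∉xs

unique-↭ : {xs ys : List A} → Unique xs → Unique ys →
           (∀ {x} → x ∈ xs → x ∈ ys) → (∀ {x} → x ∈ ys → x ∈ xs) → xs ↭ ys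
unique-↭ xs! ys! f g = ∼bag⇒↭ (unique∧set⇒bag xs! ys! (mk⇔ f g))

module _ (R : A → B → Set) {ys : List B} where

  -- Chooses one partner in `ys` for each entry of `xs`; injectivity of `R` keeps the chosen
  -- partners distinct. With a relation, the two bijections below need not be presented as pairs of
  -- inverse functions.
  image : (xs : List A) → Unique xs →
          (∀ {x} → x ∈ xs → ∃ λ y → y ∈ ys × R x y) →
          (∀ {x x′ y} → x ∈ xs → x′ ∈ xs → R x y → R x′ y → x ≡ x′) →
          ∃ λ zs → length xs ≡ length zs × Unique zs
                 × (∀ {z} → z ∈ zs → z ∈ ys × ∃ λ x → x ∈ xs × R x z)
                 × (∀ {x} → x ∈ xs → ∃ λ z → z ∈ zs × R x z)
  image [] _ _ _ = [] , refl , [] , (λ ()) , (λ ())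
  image (x ∷ xs) xs!@(_ ∷ xs!′) total inj
    with image xs xs!′ (total ∘ there) (λ p q → inj (there p) (there q)) | total (here refl)
  ... | zs , eq , zs! , back , fwd | y , y∈ys , Rxy =
    y ∷ zs , cong suc eq , All.tabulate fresh ∷ zs! , back′ , fwd′
    where
    fresh : ∀ {z} → z ∈ zs → y ≢ z
    fresh z∈zs refl with back z∈zs
    ... | _ , x′ , x′∈xs , Rx′y =
      unique⇒∉ xs! (subst (_∈ xs) (inj (there x′∈xs) (here refl) Rx′y Rxy) x′∈xs)
    back′ : ∀ {z} → z ∈ y ∷ zs → z ∈ ys × ∃ λ x′ → x′ ∈ x ∷ xs × R x′ z
    back′ (here refl) = y∈ys , x , here refl , Rxy
    back′ (there z∈zs) with back z∈zs
    ... | z∈ys , x′ , x′∈xs , Rx′z = z∈ys , x′ , there x′∈xs , Rx′z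
    fwd′ : ∀ {x′} → x′ ∈ x ∷ xs → ∃ λ z → z ∈ y ∷ zs × R x′ z
    fwd′ (here refl) = y , here refl , Rxy
    fwd′ (there x′∈xs) with fwd x′∈xs
    ... | z , z∈zs , Rx′z = z , there z∈zs , Rx′z

  -- The chosen partners exhaust `ys`: a given `y` is related to some `x`, and by functionality the
  -- partner chosen for `x` is `y`. Repetition-free lists with the same members are permutations of
  -- each other.
  bijective⇒length-≡ : {xs : List A} → Unique xs → Unique ys →
    (∀ {x} → x ∈ xs → ∃ λ y → y ∈ ys × R x y) →
    (∀ {y} → y ∈ ys → ∃ λ x → x ∈ xs × R x y) →
    (∀ {x y y′} → x ∈ xs → y ∈ ys → y′ ∈ ys → R x y → R x y′ → y ≡ y′) →
    (∀ {x x′ y} → x ∈ xs → x′ ∈ xs → R x y → R x′ y → x ≡ x′) →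
    length xs ≡ length ys
  bijective⇒length-≡ {xs} xs! ys! total surj functional inj with image xs xs! total inj
  ... | zs , eq , zs! , back , fwd =
    trans eq (↭-length (unique-↭ zs! ys! (proj₁ ∘ back) from))
    where
    from : ∀ {y} → y ∈ ys → y ∈ zs
    from y∈ys with surj y∈ys
    ... | x , x∈xs , Rxy with fwd x∈xs
    ... | z , z∈zs , Rxz =
      subst (_∈ zs) (functional x∈xs (proj₁ (back z∈zs)) y∈ys Rxz Rxy) z∈zs

∈-tail : ∀ {x y : A} {xs} → x ∈ y ∷ xs → x ≢ y → x ∈ xs
∈-tail (here x≡y)   x≢y = contradiction x≡y x≢y
∈-tail (there x∈xs) _   = x∈xs

-- If the heads differed, each would occur after the other, against asymmetry. This makes an avoider
-- unique once its letters are known to be sorted by an order that depends on `m` alone.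
sorted-unique : {R : Rel A 0ℓ} → Asymmetric R → ∀ {xs ys} → AllPairs R xs → AllPairs R ys →
                (∀ {x} → x ∈ xs → x ∈ ys) → (∀ {x} → x ∈ ys → x ∈ xs) → xs ≡ ys
sorted-unique asym [] [] _ _ = refl
sorted-unique asym [] (_ ∷ _) _ g with g (here refl)
... | ()
sorted-unique asym (_ ∷ _) [] f _ with f (here refl)
... | ()
sorted-unique {R = R} asym {x ∷ xs} {y ∷ ys} (px ∷ xs↗) (py ∷ ys↗) f g with heads
  where
  heads : x ≡ y
  heads with f (here refl) | g (here refl)
  ... | here x≡y   | _          = x≡y
  ... | there _    | here y≡x   = sym y≡x
  ... | there x∈ys | there y∈xs = contradiction (All.lookup px y∈xs) (asym (All.lookup py x∈ys))
... | refl = cong (x ∷_) (sorted-unique asym xs↗ ys↗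
    (λ z∈xs → ∈-tail (f (there z∈xs)) λ { refl → irr (All.lookup px z∈xs) })
    (λ z∈ys → ∈-tail (g (there z∈ys)) λ { refl → irr (All.lookup py z∈ys) }))
  where
  irr : ¬ R x x
  irr r = asym r r

-- Suffix maxima

private
  variable
    b i j x y M M′ : Fin n
    m m′ : Fin n → Fin n
    v w w′ : List (Fin n)

IsMax : Fin n → List (Fin n) → Set
IsMax M w = M ∈ w × All (_≤ M) w

maximum : (x : Fin n) (w : List (Fin n)) → ∃ λ M → IsMax M (x ∷ w)
maximum x [] = x , here refl , ℕ.≤-refl ∷ []
maximum x (y ∷ w) with maximum y w
... | M , M∈ , ≤M with ≤-total x M
... | inj₁ x≤M = M , there M∈ , x≤M ∷ ≤M
... | inj₂ M≤x = x , here refl , ℕ.≤-refl ∷ All.map (λ i≤M → ℕ.≤-trans i≤M M≤x) ≤M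

IsMax-unique : IsMax M w → IsMax M′ w → M ≡ M′
IsMax-unique (M∈ , ≤M) (M′∈ , ≤M′) = ≤-antisym (All.lookup ≤M′ M∈) (All.lookup ≤M M′∈)

-- Indexed by letters rather than positions, so that `m` can be read as a function on [n]. Values at
-- letters outside the word are left free.
data SuffixMax (m : Fin n → Fin n) : List (Fin n) → Set where
  []  : SuffixMax m []
  _∷_ : IsMax (m x) (x ∷ w) → SuffixMax m w → SuffixMax m (x ∷ w)

SuffixMax-cong : All (λ i → m i ≡ m′ i) w → SuffixMax m w → SuffixMax m′ w
SuffixMax-cong [] [] = []
SuffixMax-cong (eq ∷ eqs) (p ∷ ps) = subst (λ M → IsMax M _) eq p ∷ SuffixMax-cong eqs ps

suffixMax : Unique w → ∃ λ m → SuffixMax {n} m w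
-- The starting function is arbitrary: each letter overwrites its own value, and uniqueness protects
-- the values already set for the letters to its right.
suffixMax [] = id , []
suffixMax {w = x ∷ w} (x∉w ∷ w!) with suffixMax w! | maximum x w
... | m , p | M , q = updateAt m x (const M)
  , subst (λ M → IsMax M (x ∷ w)) (sym (updateAt-updates x m)) q
  ∷ SuffixMax-cong (All.map (λ x≢i → sym (updateAt-minimal _ x m (x≢i ∘ sym))) x∉w) p

suffixMax-head : SuffixMax m (x ∷ w) → IsMax (m x) (x ∷ w)
suffixMax-head (p ∷ _) = p

SuffixMax-functional : SuffixMax m w → SuffixMax m′ w → i ∈ w → m i ≡ m′ i
SuffixMax-functional (p ∷ _)  (q ∷ _)  (here refl)  = IsMax-unique p q
SuffixMax-functional (_ ∷ ps) (_ ∷ qs) (there i∈w) = SuffixMax-functional ps qs i∈w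

suffixMax-∈ : SuffixMax m w → i ∈ w → m i ∈ w
suffixMax-∈ ((mx∈ , _) ∷ _) (here refl)  = mx∈
suffixMax-∈ (_ ∷ ps)        (there i∈w) = there (suffixMax-∈ ps i∈w)

suffixMax-≥ : SuffixMax m w → i ∈ w → i ≤ m i
suffixMax-≥ ((_ , x≤mx ∷ _) ∷ _) (here refl)  = x≤mx
suffixMax-≥ (_ ∷ ps)             (there i∈w) = suffixMax-≥ ps i∈w

suffixMax-antitone : SuffixMax m (x ∷ w) → j ∈ w → m j ≤ m x
suffixMax-antitone ((_ , _ ∷ w≤mx) ∷ ps) j∈w = All.lookup w≤mx (suffixMax-∈ ps j∈w)

-- If `m x` lies strictly to the right of `x`, its own suffix maximum is at most `m x` because
-- suffix maxima decrease along the word, and at least `m x` because they dominate their letter.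
suffixMax-idempotent : SuffixMax m w → i ∈ w → m (m i) ≡ m i
suffixMax-idempotent {m = m} ((here mx≡x , _) ∷ _) (here refl) = cong m mx≡x
suffixMax-idempotent sm@((there mx∈w , _) ∷ ps) (here refl) =
  ≤-antisym (suffixMax-antitone sm mx∈w) (suffixMax-≥ ps mx∈w)
suffixMax-idempotent (_ ∷ ps) (there i∈w) = suffixMax-idempotent ps i∈w

-- The shape of the avoiders

data AscentsToSuffixMax {n} : List (Fin n) → Set where
  singleton : AscentsToSuffixMax [ x ]
  _∷_ : (x < y → All (_≤ y) w) → AscentsToSuffixMax (y ∷ w) → AscentsToSuffixMax (x ∷ y ∷ w)

-- In a whole word each letter passed by `climb` is a left-to-right maximum followed at once by
-- another, hence a fixed point of π̂; `peak` opens the last cycle. At `M` itself the ascent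
-- condition is vacuous, as no letter exceeds `M`.
data Shape {n} : List (Fin n) → Set where
  peak  : All (_≤ M) v → AscentsToSuffixMax (M ∷ v) → Shape (M ∷ v)
  climb : x < y → Shape (y ∷ w) → Shape (x ∷ y ∷ w)

-- The order of letters given by the suffix maxima, with `fromℕ k` as the largest letter

module Order {k} (m : Fin (suc k) → Fin (suc k)) where

  infix 4 _≺_
  -- The order in which the letters of the avoider with suffix maxima m occur.
  data _≺_ (i j : Fin (suc k)) : Set where
    later : m j < m i → i ≺ j
    top   : m i ≡ m j → m i ≡ fromℕ k → i < j → i ≺ j
    inner : m i ≡ m j → m i ≢ fromℕ k → i < m i → j ≡ m i ⊎ j < i → i ≺ j

  ≺⇒≥ : i ≺ j → m j ≤ m i
  ≺⇒≥ (later lt)       = ℕ.<⇒≤ lt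
  ≺⇒≥ (top eq _ _)     rewrite eq = ℕ.≤-refl
  ≺⇒≥ (inner eq _ _ _) rewrite eq = ℕ.≤-refl

  ≺-irrefl : ¬ i ≺ i
  ≺-irrefl (later lt)                = ℕ.<-irrefl refl lt
  ≺-irrefl (top _ _ lt)              = ℕ.<-irrefl refl lt
  ≺-irrefl (inner _ _ lt (inj₁ i≡M)) = <⇒≢ lt i≡M
  ≺-irrefl (inner _ _ _ (inj₂ lt))   = ℕ.<-irrefl refl lt

  ≺-trans : ∀ {i j l} → i ≺ j → j ≺ l → i ≺ l
  ≺-trans (later p) q = later (ℕ.≤-<-trans (≺⇒≥ q) p)
  ≺-trans p@(top _ _ _) (later q) = later (ℕ.<-≤-trans q (≺⇒≥ p))
  ≺-trans p@(inner _ _ _ _) (later q) = later (ℕ.<-≤-trans q (≺⇒≥ p))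
  ≺-trans (top eq t p) (top eq′ _ q) = top (trans eq eq′) t (ℕ.<-trans p q)
  ≺-trans (top eq t _) (inner _ ¬t _ _) = contradiction (trans (sym eq) t) ¬t
  ≺-trans (inner eq ¬t _ _) (top _ t _) = contradiction (trans eq t) ¬t
  ≺-trans (inner eq ¬t p _) (inner eq′ _ _ (inj₁ l≡)) =
    inner (trans eq eq′) ¬t p (inj₁ (trans l≡ (sym eq)))
  -- Here `j` is the maximum of its fibre, so `j < m j` is impossible.
  ≺-trans (inner eq ¬t p (inj₁ j≡)) (inner eq′ _ q (inj₂ _)) =
    contradiction (trans j≡ eq) (<⇒≢ q)
  ≺-trans (inner eq ¬t p (inj₂ j<i)) (inner eq′ _ _ (inj₂ l<j)) =
    inner (trans eq eq′) ¬t p (inj₂ (ℕ.<-trans l<j j<i))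

  ≺-asym : Asymmetric _≺_
  ≺-asym p q = ≺-irrefl (≺-trans p q)

  -- In an ascent `x < y` the letter `y` bounds everything after it, so it is the suffix maximum at
  -- both letters and ends its fibre. In a descent either `x` is its own suffix maximum and all
  -- later letters lie in lower fibres, or the maximum comes after `x`; then `x` and `y` share it,
  -- and `x` stands to later letters as `y` does.
  tail-sorted : AscentsToSuffixMax (x ∷ w) → SuffixMax m (x ∷ w) → Unique (x ∷ w) →
                All (λ i → m i ≢ fromℕ k) (x ∷ w) → AllPairs _≺_ (x ∷ w)
  tail-sorted singleton _ _ _ = [] ∷ []
  tail-sorted {x = x} {w = y ∷ w} (asc ∷ ascs)
      sm@((mx∈ , x≤ ∷ w≤mx) ∷ sms@(_ ∷ smw)) w!@(_ ∷ w!′) (x≢top ∷ ≢top)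
    with tail-sorted ascs sms w!′ ≢top
  ... | y≺ ∷ sorted with <-cmp x y
  ... | tri≈ _ refl _ = contradiction (here refl) (unique⇒∉ w!)
  ... | tri< x<y _ _ = (x≺y ∷ All.tabulate rest) ∷ y≺ ∷ sorted
    where
    mx≡y : m x ≡ y
    mx≡y = IsMax-unique (mx∈ , x≤ ∷ w≤mx) (there (here refl) , ℕ.<⇒≤ x<y ∷ ℕ.≤-refl ∷ asc x<y)
    my≡y : m y ≡ y
    my≡y = IsMax-unique (suffixMax-head sms) (here refl , ℕ.≤-refl ∷ asc x<y)
    x≺y : x ≺ y
    x≺y = inner (trans mx≡y (sym my≡y)) x≢top (subst (x <_) (sym mx≡y) x<y) (inj₁ (sym mx≡y))
    rest : j ∈ w → x ≺ j
    rest {j} j∈w = later (subst (m j <_) (sym mx≡y)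
      (≤∧≢⇒< (All.lookup (asc x<y) mj∈w) λ mj≡y → unique⇒∉ w!′ (subst (_∈ w) mj≡y mj∈w)))
      where
      mj∈w = suffixMax-∈ smw j∈w
  ... | tri> _ _ y<x with m x ≟ x
  ... | yes mx≡x = All.tabulate rest ∷ y≺ ∷ sorted
    where
    rest : j ∈ y ∷ w → x ≺ j
    rest {j} j∈ = later (≤∧≢⇒< (suffixMax-antitone sm j∈)
      λ mj≡mx → unique⇒∉ w! (subst (_∈ y ∷ w) (trans mj≡mx mx≡x) (suffixMax-∈ sms j∈)))
  ... | no mx≢x = (inner mx≡my x≢top x<mx (inj₂ y<x) ∷ All.map rest y≺) ∷ y≺ ∷ sorted
    where
    x<mx : x < m x
    x<mx = ≤∧≢⇒< x≤ (mx≢x ∘ sym)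
    mx≡my : m x ≡ m y
    mx≡my = ≤-antisym (All.lookup (proj₂ (suffixMax-head sms)) (∈-tail mx∈ mx≢x))
                      (suffixMax-antitone sm (here refl))
    rest : y ≺ j → x ≺ j
    rest {j} (later lt) = later (subst (m j <_) (sym mx≡my) lt)
    rest (top _ my≡top _) = contradiction (trans mx≡my my≡top) x≢top
    rest (inner eq _ _ (inj₁ j≡)) = inner (trans mx≡my eq) x≢top x<mx (inj₁ (trans j≡ (sym mx≡my)))
    rest (inner eq _ _ (inj₂ j<y)) = inner (trans mx≡my eq) x≢top x<mx (inj₂ (ℕ.<-trans j<y y<x))

  -- During the climb the largest letter is still to come, so `x` and `y` both lie in its fibre,
  -- which is ordered increasingly. At the peak `M` is its own suffix maximum and does not recur, so
  -- all later letters lie in lower fibres and `tail-sorted` applies to them.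
  shape⇒sorted : Shape (x ∷ w) → SuffixMax m (x ∷ w) → Unique (x ∷ w) →
                 fromℕ k ∈ x ∷ w → AllPairs _≺_ (x ∷ w)
  shape⇒sorted {x = M} {w = v} (peak v≤M asc) sm@((mM∈ , ≤mM) ∷ sms) w!@(_ ∷ v!) top∈ =
    All.tabulate (λ j∈v → later (mj<mM j∈v)) ∷ tail v asc sms v! λ j∈v → mj<mM j∈v
    where
    mM≡M : m M ≡ M
    mM≡M = IsMax-unique (mM∈ , ≤mM) (here refl , ℕ.≤-refl ∷ v≤M)
    mj<mM : j ∈ v → m j < m M
    mj<mM j∈v = ≤∧≢⇒< (suffixMax-antitone sm j∈v) λ mj≡mM →
      unique⇒∉ w! (subst (_∈ v) (trans mj≡mM mM≡M) (suffixMax-∈ sms j∈v))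
    -- A case split on the letters after `M` discards the condition on the step out of `M`.
    tail : ∀ u → AscentsToSuffixMax (M ∷ u) → SuffixMax m u → Unique u →
           (∀ {j} → j ∈ u → m j < m M) → AllPairs _≺_ u
    tail [] _ _ _ _ = []
    tail (_ ∷ _) (_ ∷ asc) sm u! lt = tail-sorted asc sm u! (All.tabulate λ j∈u mj≡top →
      ℕ.<⇒≱ (lt j∈u) (subst (m M ≤_) (sym mj≡top) (≤fromℕ (m M))))
  shape⇒sorted {x = x} {w = y ∷ w} (climb x<y shape) sm@((_ , ≤mx) ∷ sms) (_ ∷ w!) top∈ =
    (top (trans mx≡top (sym my≡top)) mx≡top x<y ∷ All.map rest y≺) ∷ y≺ ∷ sorted
    where
    top∈′ : fromℕ k ∈ y ∷ w
    top∈′ = ∈-tail top∈ λ { refl → ℕ.<⇒≱ x<y (≤fromℕ y) }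
    mx≡top : m x ≡ fromℕ k
    mx≡top = ≤-antisym (≤fromℕ (m x)) (All.lookup ≤mx top∈)
    my≡top : m y ≡ fromℕ k
    my≡top = ≤-antisym (≤fromℕ (m y)) (All.lookup (proj₂ (suffixMax-head sms)) top∈′)
    ih = shape⇒sorted shape sms w! top∈′
    y≺ = AllPairs.head ih
    sorted = AllPairs.tail ih
    rest : y ≺ j → x ≺ j
    rest {j} (later lt) = later (subst (m j <_) (trans my≡top (sym mx≡top)) lt)
    rest (top eq _ y<j) = top (trans mx≡top (trans (sym my≡top) eq)) mx≡top (ℕ.<-trans x<y y<j)
    rest (inner _ my≢top _ _) = contradiction my≡top my≢top

  -- Recovering the word from a block-maximum function

  module _ (inflationary : ∀ i → i ≤ m i) (idempotent : ∀ i → m (m i) ≡ m i) where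

    Closed : List (Fin (suc k)) → Set
    Closed w = ∀ {i} → i ∈ w → m i ∈ w

    -- The value `m j` is the maximum of the fibre of `j` and its last letter, so it cannot precede
    -- `j`. Hence dropping the head of a sorted closed word never removes the maximum of a remaining
    -- letter's fibre.
    ≺⇒≢ : i ≺ j → m j ≢ i
    ≺⇒≢ (later lt) refl = <⇒≢ lt (sym (idempotent _))
    ≺⇒≢ (top _ _ lt) refl = ℕ.<⇒≱ lt (inflationary _)
    ≺⇒≢ (inner _ _ lt _) refl = <⇒≢ lt (sym (idempotent _))

    closed-tail : All (x ≺_) w → Closed (x ∷ w) → Closed w
    closed-tail x≺ closed i∈w = ∈-tail (closed (there i∈w)) (≺⇒≢ (All.lookup x≺ i∈w))

    sorted⇒suffixMax : AllPairs _≺_ w → Closed w → SuffixMax m w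
    sorted⇒suffixMax [] closed = []
    sorted⇒suffixMax (x≺ ∷ sorted) closed =
      (closed (here refl) , inflationary _ ∷ All.map (λ x≺j → ℕ.≤-trans (inflationary _) (≺⇒≥ x≺j)) x≺)
      ∷ sorted⇒suffixMax sorted (closed-tail x≺ closed)

    -- Since `y` and all letters after it lie in lower fibres, `x` is the last letter of its fibre
    -- in the word. Closedness puts the fibre's maximum in the word, and it can only be `x`.
    later⇒fixed : m y < m x → All (y ≺_) w → Closed (x ∷ y ∷ w) → m x ≡ x
    later⇒fixed lt y≺ closed with closed (here refl)
    ... | here mx≡x = mx≡x
    ... | there (here mx≡y) = contradiction (trans (sym (cong m mx≡y)) (idempotent _)) (<⇒≢ lt)
    ... | there (there mx∈w) =
      contradiction (subst (_≤ m _) (idempotent _) (≺⇒≥ (All.lookup y≺ mx∈w))) (ℕ.<⇒≱ lt)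

    -- Outside the top fibre the only ascent is the step to the maximum `y` of a fibre, and then j ≤
    -- m j ≤ m y = y for every later `j`. The head is exempt from the condition on fibres so that
    -- the word may start with the largest letter.
    sorted⇒ascents : AllPairs _≺_ (x ∷ w) → Closed (x ∷ w) → All (λ i → m i ≢ fromℕ k) w →
                     AscentsToSuffixMax (x ∷ w)
    sorted⇒ascents ([] ∷ []) _ _ = singleton
    sorted⇒ascents {x = x} {w = y ∷ w} (x≺@(x≺y ∷ _) ∷ sorted@(y≺ ∷ _)) closed (y≢top ∷ ≢top) =
      ascent x≺y ∷ sorted⇒ascents sorted (closed-tail x≺ closed) ≢top
      where
      ascent : x ≺ y → x < y → All (_≤ y) w
      ascent (later lt) x<y = contradiction (inflationary y)
        (ℕ.<⇒≱ (ℕ.<-trans (subst (m y <_) (later⇒fixed lt y≺ closed) lt) x<y))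
      ascent (top eq t _) _ = contradiction (trans (sym eq) t) y≢top
      ascent (inner _ _ _ (inj₂ y<x)) x<y = contradiction x<y (ℕ.<-asym y<x)
      ascent (inner eq _ _ (inj₁ y≡mx)) _ = All.map (λ {j} y≺j →
        ℕ.≤-trans (inflationary j) (subst (m j ≤_) (sym (trans y≡mx eq)) (≺⇒≥ y≺j))) y≺

    -- The word climbs while the next letter stays in the top fibre. When it leaves, the current
    -- letter equals its own value under `m`, which is the largest letter, and this is the peak.
    sorted⇒shape′ : AllPairs _≺_ (x ∷ w) → Closed (x ∷ w) → m x ≡ fromℕ k → Shape (x ∷ w)
    sorted⇒shape′ ([] ∷ []) _ _ = peak [] singleton
    sorted⇒shape′ {x = x} {w = y ∷ w} (x≺@(x≺y ∷ _) ∷ sorted@(y≺ ∷ _)) closed mx≡top with x≺y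
    ... | inner _ mx≢top _ _ = contradiction mx≡top mx≢top
    ... | top eq _ x<y =
      climb x<y (sorted⇒shape′ sorted (closed-tail x≺ closed) (trans (sym eq) mx≡top))
    ... | later lt =
      peak (All.map (λ {j} x≺j → ℕ.≤-trans (inflationary j) (subst (m j ≤_) mx≡x (≺⇒≥ x≺j))) x≺)
           (sorted⇒ascents (x≺ ∷ sorted) closed
             ((λ my≡top → <⇒≢ lt (trans my≡top (sym mx≡top)))
              ∷ All.map (λ y≺j mj≡top → ℕ.<⇒≱ (ℕ.≤-<-trans (≺⇒≥ y≺j) lt)
                  (subst (m x ≤_) (sym mj≡top) (≤fromℕ (m x)))) y≺))
      where
      mx≡x = later⇒fixed lt y≺ closed

    sorted⇒shape : AllPairs _≺_ w → Closed w → SuffixMax m w → fromℕ k ∈ w → Shape w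
    sorted⇒shape {w = _ ∷ _} sorted closed ((_ , ≤mx) ∷ _) top∈ =
      sorted⇒shape′ sorted closed (≤-antisym (≤fromℕ _) (All.lookup ≤mx top∈))

    ≺-total : i ≢ j → i ≺ j ⊎ j ≺ i
    ≺-total {i} {j} i≢j with <-cmp (m i) (m j)
    ... | tri< lt _ _ = inj₂ (later lt)
    ... | tri> _ _ lt = inj₁ (later lt)
    ... | tri≈ _ eq _ with m i ≟ fromℕ k
    ... | yes t with <-cmp i j
    ... | tri< lt _ _ = inj₁ (top eq t lt)
    ... | tri≈ _ i≡j _ = contradiction i≡j i≢j
    ... | tri> _ _ lt = inj₂ (top (sym eq) (trans (sym eq) t) lt)
    ≺-total {i} {j} i≢j | tri≈ _ eq _ | no ¬t with i ≟ m i | j ≟ m j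
    ... | yes i≡ | yes j≡ = contradiction (trans i≡ (trans eq (sym j≡))) i≢j
    ... | yes i≡ | no j≢ = inj₂ (inner (sym eq) (¬t ∘ trans eq)
                                       (≤∧≢⇒< (inflationary j) j≢) (inj₁ (trans i≡ eq)))
    ... | no i≢ | yes j≡ = inj₁ (inner eq ¬t (≤∧≢⇒< (inflationary i) i≢) (inj₁ (trans j≡ (sym eq))))
    ... | no i≢ | no j≢ with <-cmp i j
    ... | tri< lt _ _ = inj₂ (inner (sym eq) (¬t ∘ trans eq) (≤∧≢⇒< (inflationary j) j≢) (inj₂ lt))
    ... | tri≈ _ i≡j _ = contradiction i≡j i≢j
    ... | tri> _ _ lt = inj₁ (inner eq ¬t (≤∧≢⇒< (inflationary i) i≢) (inj₂ lt))

    ≺-compare : Trichotomous _≡_ _≺_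
    ≺-compare i j with i ≟ j
    ... | yes refl = tri≈ ≺-irrefl refl ≺-irrefl
    ... | no i≢j with ≺-total i≢j
    ... | inj₁ i≺j = tri< i≺j i≢j (≺-asym i≺j)
    ... | inj₂ j≺i = tri> (≺-asym j≺i) i≢j j≺i

    ≼-decTotalOrder : DecTotalOrder 0ℓ 0ℓ 0ℓ
    ≼-decTotalOrder = record
      { isDecTotalOrder = NonStrict.isDecTotalOrder _≡_ _≺_ record
        { isStrictPartialOrder = record
          { isEquivalence = isEquivalence
          ; irrefl        = λ { refl → ≺-irrefl }
          ; trans         = ≺-trans
          ; <-resp-≈      = resp₂ _≺_
          }
        ; compare = ≺-compare
        }
      }

    -- Sorting uses the reflexive closure of `_≺_`; the absence of repetitions then makes the result
    -- strictly sorted.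
    sortedWord : ∃ λ w → AllPairs _≺_ w × w ↭ allFin (suc k)
    sortedWord = sort (allFin (suc k)) , AllPairs.zipWith strict (≼-sorted , w!) , w↭
      where
      open import Data.List.Sort ≼-decTotalOrder using (sort; sort-↭; sort-↗)
      w↭ : sort (allFin (suc k)) ↭ allFin (suc k)
      w↭ = sort-↭ (allFin (suc k))
      w! : Unique (sort (allFin (suc k)))
      w! = Setoid↭.Unique-resp-↭ (setoid (Fin (suc k))) (↭⇒↭ₛ (↭-sym w↭)) (allFin⁺ (suc k))
      ≼-sorted = Linked⇒AllPairs (DecTotalOrder.trans ≼-decTotalOrder) (sort-↗ (allFin (suc k)))
      strict : ∀ {i j} → (i ≺ j ⊎ i ≡ j) × i ≢ j → i ≺ j
      strict (inj₁ i≺j , _)   = i≺j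
      strict (inj₂ i≡j , i≢j) = contradiction i≡j i≢j

-- The graph of π̂

edges : List (Fin n) → List (Fin n × Fin n)
edges w = concatMap cycleGraph (cycles w)

map-proj₁-zip : ∀ (x : A) xs {z : A} → map proj₁ (zip (x ∷ xs) (xs ∷ʳ z)) ≡ x ∷ xs
map-proj₁-zip x []       = refl
map-proj₁-zip x (y ∷ xs) = cong (x ∷_) (map-proj₁-zip y xs)

∈-zip⇒∈ʳ : ∀ {x : A} {y : B} xs {ys} → (x , y) ∈ zip xs ys → y ∈ ys
∈-zip⇒∈ʳ (_ ∷ xs) {_ ∷ ys} (here refl) = here refl
∈-zip⇒∈ʳ (_ ∷ xs) {_ ∷ ys} (there e)  = there (∈-zip⇒∈ʳ xs e)

graph-keys : (cs : List (List A)) → map proj₁ (concatMap cycleGraph cs) ≡ concat cs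
graph-keys []              = refl
graph-keys ([] ∷ cs)       = graph-keys cs
graph-keys ((x ∷ c) ∷ cs) =
  trans (map-++ proj₁ (cycleGraph (x ∷ c)) _) (cong₂ _++_ (map-proj₁-zip x c) (graph-keys cs))

concat-cyclesFrom : ∀ (x : Fin n) c w → concat (cyclesFrom x c w) ≡ c ++ w
concat-cyclesFrom x c [] = refl
concat-cyclesFrom x c (y ∷ w) with does (x <? y)
... | true  = cong (c ++_) (concat-cyclesFrom y [ y ] w)
... | false = trans (concat-cyclesFrom x (c ∷ʳ y) w) (++-assoc c [ y ] w)

concat-cycles : (w : List (Fin n)) → concat (cycles w) ≡ w
concat-cycles []      = refl
concat-cycles (x ∷ w) = concat-cyclesFrom x [ x ] w

-- The cycles cut the word into consecutive pieces, so the sources of the arrows spell it again. For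
-- a repetition-free word the list of arrows is therefore the graph of a function.
edges-keys : (w : List (Fin n)) → map proj₁ (edges w) ≡ w
edges-keys w = trans (graph-keys (cycles w)) (concat-cycles w)

evaluate-∈ : ∀ (g : List (Fin n × Fin n)) → x ∈ map proj₁ g → (x , evaluate g x) ∈ g
evaluate-∈ {x = x} ((a , b) ∷ g) x∈ with x ≟ a
... | yes refl = here refl
... | no x≢a   = there (evaluate-∈ g (∈-tail x∈ x≢a))

evaluate-≡ : ∀ {g : List (Fin n × Fin n)} → Unique (map proj₁ g) → (x , y) ∈ g → evaluate g x ≡ y
evaluate-≡ {x = x} {g = (a , b) ∷ g} (a∉ ∷ g!) e with x ≟ a | e
... | yes refl | here refl = refl
... | yes refl | there e′  = contradiction (∈-map⁺ proj₁ e′) (unique⇒∉ (a∉ ∷ g!))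
... | no x≢a   | here refl = contradiction refl x≢a
... | no _     | there e′  = evaluate-≡ g! e′

module _ {x : Fin n} {c w : List (Fin n)} where

  cyclesFrom-< : x < y → cyclesFrom x c (y ∷ w) ≡ c ∷ cyclesFrom y [ y ] w
  cyclesFrom-< {y} x<y rewrite dec-true (x <? y) x<y = refl

  cyclesFrom-≥ : y ≤ x → cyclesFrom x c (y ∷ w) ≡ cyclesFrom x (c ∷ʳ y) w
  cyclesFrom-≥ {y} y≤x rewrite dec-false (x <? y) (ℕ.≤⇒≯ y≤x) = refl

cyclesFrom-single : ∀ {c} → All (_≤ x) w → cyclesFrom x c w ≡ [ c ++ w ]
cyclesFrom-single {c = c} [] = cong [_] (sym (++-identityʳ c))
cyclesFrom-single {w = y ∷ w} {c = c} (y≤x ∷ w≤x) =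
  trans (cyclesFrom-≥ {w = w} y≤x) (trans (cyclesFrom-single w≤x) (cong [_] (++-assoc c [ y ] w)))

edges-single : All (_≤ x) w → edges (x ∷ w) ≡ zip (x ∷ w) (w ∷ʳ x)
edges-single {x = x} {w = w} w≤x rewrite cyclesFrom-single {c = [ x ]} w≤x = ++-identityʳ _

edges-< : x < y → edges (x ∷ y ∷ w) ≡ (x , x) ∷ edges (y ∷ w)
edges-< {x = x} {w = w} x<y = cong (concatMap cycleGraph) (cyclesFrom-< {c = [ x ]} {w = w} x<y)

last∈zip : ∀ (x : A) xs {y z} → (z , y) ∈ zip (x ∷ (xs ∷ʳ z)) ((xs ∷ʳ z) ∷ʳ y)
last∈zip x []       = there (here refl)
last∈zip x (_ ∷ xs) = there (last∈zip _ xs)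

-- Reads on to the end of the cycle opened by `x`, keeping its last letter `z` visible. A cycle with
-- a second letter ends below `x`, so its closing arrow ascends to `x`.
closing-edge : ∀ c {z} w → z < x → All (x ≢_) w →
  ∃ λ a → a < x × (a , x) ∈ concatMap cycleGraph (cyclesFrom x (x ∷ (c ∷ʳ z)) w)
closing-edge {x = x} c {z} [] z<x _ = z , z<x , ∈-++⁺ˡ (last∈zip x c)
closing-edge {x = x} c {z} (y ∷ w) z<x (x≢y ∷ x∉w) with <-cmp x y
... | tri< x<y _ _ rewrite cyclesFrom-< {c = x ∷ (c ∷ʳ z)} {w = w} x<y = z , z<x , ∈-++⁺ˡ (last∈zip x c)
... | tri≈ _ x≡y _ = contradiction x≡y x≢y
... | tri> _ _ y<x rewrite cyclesFrom-≥ {c = x ∷ (c ∷ʳ z)} {w = w} (ℕ.<⇒≤ y<x) =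
  closing-edge (c ∷ʳ z) w y<x x∉w

-- Targets of ascending arrows

data Undominated {n} (b : Fin n) : List (Fin n) → Set where
  here  : All (_≤ b) w → Undominated b (b ∷ w)
  there : Undominated b w → Undominated b (x ∷ w)

undominated⇒∈ : Undominated b w → b ∈ w
undominated⇒∈ (here _)  = here refl
undominated⇒∈ (there u) = there (undominated⇒∈ u)

-- The arrows of a single cycle join adjacent letters, apart from the closing one into `M`. An
-- ascending arrow is thus either an adjacent ascent or the closing arrow.
ascentTops : ∀ {a} → AscentsToSuffixMax (x ∷ v) → (a , b) ∈ zip (x ∷ v) (v ∷ʳ M) → a < b →
             b ≡ M ⊎ Undominated b v
ascentTops singleton (here refl) _ = inj₁ refl
ascentTops (asc ∷ _) (here refl) a<b = inj₂ (here (asc a<b))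
ascentTops (_ ∷ ascs) (there e) a<b with ascentTops ascs e a<b
... | inj₁ b≡M = inj₁ b≡M
... | inj₂ u   = inj₂ (there u)

ascents : Unique v → M ∉ v →
          (∀ {a b} → (a , b) ∈ zip (x ∷ v) (v ∷ʳ M) → a < b → b ≡ M ⊎ Undominated b v) →
          AscentsToSuffixMax (x ∷ v)
ascents {v = []} _ _ _ = singleton
ascents {v = y ∷ v} {M = M} {x = x} v!@(_ ∷ v!′) M∉ tops = ascent ∷ ascents v!′ (M∉ ∘ there) tops′
  where
  ascent : x < y → All (_≤ y) v
  ascent x<y with tops (here refl) x<y
  ... | inj₁ refl      = contradiction (here refl) M∉
  ... | inj₂ (here v≤) = v≤
  ... | inj₂ (there u) = contradiction (undominated⇒∈ u) (unique⇒∉ v!)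
  tops′ : ∀ {a b} → (a , b) ∈ zip (y ∷ v) (v ∷ʳ M) → a < b → b ≡ M ⊎ Undominated b v
  tops′ e a<b with tops (there e) a<b
  ... | inj₁ b≡M       = inj₁ b≡M
  ... | inj₂ (there u) = inj₂ u
  -- Here `b` is `y` itself, which does not recur in `v` and so can only be the target of the
  -- closing arrow.
  ... | inj₂ (here _) with ∈-++⁻ v (∈-zip⇒∈ʳ (y ∷ v) e)
  ... | inj₁ y∈v        = contradiction y∈v (unique⇒∉ v!)
  ... | inj₂ (here y≡M) = inj₁ y≡M

shape⇒undominated : ∀ {a} → Shape w → (a , b) ∈ edges w → a < b → Undominated b w
shape⇒undominated {w = M ∷ v} {b = b} {a = a} (peak v≤M asc) e a<b
  with ascentTops asc (subst ((a , b) ∈_) (edges-single v≤M) e) a<b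
... | inj₁ refl = here v≤M
... | inj₂ u    = there u
shape⇒undominated {w = x ∷ y ∷ w} {b = b} {a = a} (climb x<y shape) e a<b
  with subst ((a , b) ∈_) (edges-< {w = w} x<y) e
... | here refl = contradiction a<b (ℕ.<-irrefl refl)
... | there e′  = there (shape⇒undominated shape e′ a<b)

-- If the first two letters ascend, `x` is a 1-cycle and the rest is treated in the same way. If
-- they descend, the cycle opened by `x` has a closing arrow ascending to `x`, so no later letter
-- exceeds `x` and the whole word is one cycle.
undominated⇒shape : Unique (x ∷ w) →
                    (∀ {a b} → (a , b) ∈ edges (x ∷ w) → a < b → Undominated b (x ∷ w)) →
                    Shape (x ∷ w)
undominated⇒shape {w = []} _ _ = peak [] singleton
undominated⇒shape {x = x} {w = y ∷ w} w!@((_ ∷ x∉w) ∷ w!′) und with <-cmp x y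
... | tri≈ _ refl _ = contradiction (here refl) (unique⇒∉ w!)
... | tri< x<y _ _ = climb x<y (undominated⇒shape w!′ und′)
  where
  und′ : ∀ {a b} → (a , b) ∈ edges (y ∷ w) → a < b → Undominated b (y ∷ w)
  und′ e a<b with und (subst (_ ∈_) (sym (edges-< {w = w} x<y)) (there e)) a<b
  ... | here (y≤x ∷ _) = contradiction x<y (ℕ.≤⇒≯ y≤x)
  ... | there u        = u
... | tri> _ _ y<x = peak w≤x (ascents w!′ (unique⇒∉ w!) tops)
  where
  w≤x : All (_≤ x) (y ∷ w)
  w≤x with closing-edge [] w y<x x∉w
  ... | a , a<x , e
    with und (subst (λ cs → (a , x) ∈ concatMap cycleGraph cs)
                    (sym (cyclesFrom-≥ {c = [ x ]} {w = w} (ℕ.<⇒≤ y<x))) e) a<x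
  ... | here ≤x = ≤x
  ... | there u = contradiction (undominated⇒∈ u) (unique⇒∉ w!)
  tops : ∀ {a b} → (a , b) ∈ zip (x ∷ y ∷ w) ((y ∷ w) ∷ʳ x) → a < b → b ≡ x ⊎ Undominated b (y ∷ w)
  tops e a<b with und (subst (_ ∈_) (sym (edges-single w≤x)) e) a<b
  ... | here _  = inj₁ refl
  ... | there u = inj₂ u

undominated⇒sorted : ∀ {k} (m : Vec (Fin (suc k)) (suc k)) {w} → Unique w →
  (∀ {a b} → (a , b) ∈ edges w → a < b → Undominated b w) → SuffixMax (Vec.lookup m) w →
  fromℕ k ∈ w → AllPairs (Order._≺_ (Vec.lookup m)) w
undominated⇒sorted m {_ ∷ _} w! und sm top∈ =
  Order.shape⇒sorted (Vec.lookup m) (undominated⇒shape w! und) sm w! top∈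

-- Avoidance

lookup∈toList : ∀ {l} (v : Vec A l) i → Vec.lookup v i ∈ toList v
lookup∈toList (x ∷ v) zero    = here refl
lookup∈toList (x ∷ v) (suc i) = there (lookup∈toList v i)

lookup⇒All : ∀ {P : A → Set} {l} (v : Vec A l) → (∀ i → P (Vec.lookup v i)) → All P (toList v)
lookup⇒All []      p = []
lookup⇒All (x ∷ v) p = p zero ∷ lookup⇒All v (p ∘ suc)

unique-toList : ∀ {l} {v : Vec A l} → VecUnique v → Unique (toList v)
unique-toList []        = []
unique-toList (p ∷ v!) = VecAll.toList⁺ p ∷ unique-toList v!

unique-toList⁻ : ∀ {l} (v : Vec A l) → Unique (toList v) → VecUnique v
unique-toList⁻ []      []        = []
unique-toList⁻ (x ∷ v) (p ∷ v!) = VecAll.toList⁻ p ∷ unique-toList⁻ v v!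

-- A repetition-free word of length n misses no letter: otherwise prepending
-- the missing letter would inject Fin (1 + n) into Fin n.
unique⇒complete : {π : Vec (Fin n) n} → VecUnique π → ∀ x → x ∈ toList π
unique⇒complete {π = π} π! x with Any.any? (x ≟_) (toList π)
... | yes x∈ = x∈
... | no x∉ = contradiction (injective⇒≤ λ {i} {j} → lookup-injective xπ! i j) ℕ.1+n≰n
  where
  xπ! : VecUnique (x ∷ π)
  xπ! = VecAll.toList⁻ (All.tabulate λ { y∈ refl → x∉ y∈ }) ∷ π!

dominated? : ∀ {l} (v : Vec (Fin n) l) → b ∈ toList v → Undominated b (toList v)
             ⊎ ∃ λ i → ∃ λ j → i < j × Vec.lookup v i ≡ b × b < Vec.lookup v j
dominated? {b = b} (x ∷ v) (here refl) with any? (λ j → b <? Vec.lookup v j)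
... | yes (j , b<) = inj₂ (zero , suc j , s≤s z≤n , refl , b<)
... | no ¬b<       = inj₁ (here (lookup⇒All v λ j → ℕ.≮⇒≥ λ b< → ¬b< (j , b<)))
dominated? (x ∷ v) (there b∈v) with dominated? v b∈v
... | inj₁ u                       = inj₁ (there u)
... | inj₂ (i , j , i<j , eq , b<) = inj₂ (suc i , suc j , s≤s i<j , eq , b<)

-- Without repetitions, `i` must be the position at which `b` is undominated.
undominated⇒≥ : ∀ {l} (v : Vec (Fin n) l) → Unique (toList v) → Undominated b (toList v) →
                ∀ {i j} → i < j → Vec.lookup v i ≡ b → Vec.lookup v j ≤ b
undominated⇒≥ (x ∷ v) v! (here v≤b) {_} {suc j} _ _ = All.lookup v≤b (lookup∈toList v j)
undominated⇒≥ (x ∷ v) v! (there u) {zero} _ refl = contradiction (undominated⇒∈ u) (unique⇒∉ v!)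
undominated⇒≥ (x ∷ v) (_ ∷ v!) (there u) {suc i} {suc j} (s≤s i<j) eq = undominated⇒≥ v v! u i<j eq

module _ {π : Vec (Fin n) n} (π! : VecUnique π) where

  private
    w! : Unique (toList π)
    w! = unique-toList π!

  edge⇒hat : ∀ {a b} → (a , b) ∈ edges (toList π) → hat π a ≡ b
  edge⇒hat = evaluate-≡ (subst Unique (sym (edges-keys (toList π))) w!)

  hat⇒edge : ∀ {a b} → hat π a ≡ b → (a , b) ∈ edges (toList π)
  hat⇒edge {a} refl = evaluate-∈ (edges (toList π))
    (subst (a ∈_) (sym (edges-keys (toList π))) (unique⇒complete π! a))

  -- For an arrow a → b with a < b, a letter c > b to the right of `b` is exactly what completes an
  -- occurrence x₁x₂x₃ = abc.
  avoids⇒undominated : ¬ Contains π pattern23-1→2 →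
    ∀ {a b} → (a , b) ∈ edges (toList π) → a < b → Undominated b (toList π)
  avoids⇒undominated avoids {a} {b} e a<b with dominated? π (unique⇒complete π! b)
  ... | inj₁ u = u
  ... | inj₂ (i , j , i<j , πi≡b , b<πj) = contradiction occurrence avoids
    where
    occurrence : Contains π pattern23-1→2
    occurrence = a ∷ b ∷ Vec.lookup π j ∷ []
      , i ∷ j ∷ []
      , (a<b ∷ ℕ.<-trans a<b b<πj ∷ []) ∷ (b<πj ∷ []) ∷ [] ∷ []
      , (i<j ∷ []) ∷ [] ∷ []
      , (λ { zero → πi≡b ; (suc zero) → refl })
      , edge⇒hat e ∷ []

  undominated⇒avoids : (∀ {a b} → (a , b) ∈ edges (toList π) → a < b → Undominated b (toList π)) →
    ¬ Contains π pattern23-1→2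
  undominated⇒avoids und
    ( a ∷ b ∷ c ∷ [] , i ∷ j ∷ []
    , (a<b ∷ _ ∷ []) ∷ (b<c ∷ []) ∷ _ , (i<j ∷ []) ∷ _ , πt≡xν , πa≡b ∷ []) =
    ℕ.<⇒≱ b<c (subst (_≤ b) (πt≡xν (suc zero))
      (undominated⇒≥ π w! (und (hat⇒edge πa≡b) a<b) i<j (πt≡xν zero)))

-- Block-maximum functions

-- Idempotency puts each value into its own fibre and i ≤ m i makes it the largest element there. So
-- these are the maps that send every element to the maximum of its block in some set partition.
IsBlockMax : Vec (Fin n) n → Set
IsBlockMax m = ∀ i → i ≤ Vec.lookup m i × Vec.lookup m (Vec.lookup m i) ≡ Vec.lookup m i

isBlockMax? : (m : Vec (Fin n) n) → Dec (IsBlockMax m)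
isBlockMax? m = all? λ i → i ≤? Vec.lookup m i ×-dec Vec.lookup m (Vec.lookup m i) ≟ Vec.lookup m i

blockMaxima : (n : ℕ) → List (Vec (Fin n) n)
blockMaxima n = filter isBlockMax? (vectors (allFin n) n)

∈-vectors : ∀ {xs : List A} → (∀ x → x ∈ xs) → ∀ {n} (v : Vec A n) → v ∈ vectors xs n
∈-vectors xs∋ []      = here refl
∈-vectors xs∋ (x ∷ v) = ∈-cartesianProductWith⁺ _∷_ (xs∋ x) (∈-vectors xs∋ v)

vectors⁺ : ∀ {xs : List A} → Unique xs → ∀ n → Unique (vectors xs n)
vectors⁺ xs! zero    = [] ∷ []
vectors⁺ xs! (suc n) = Unique.cartesianProductWith⁺ _∷_ ∷-injective xs! (vectors⁺ xs! n)

∈-blockMaxima : {m : Vec (Fin n) n} → IsBlockMax m → m ∈ blockMaxima n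
∈-blockMaxima {m = m} p = ∈-filter⁺ isBlockMax? (∈-vectors ∈-allFin m) p

∈-blockMaxima⁻ : {m : Vec (Fin n) n} → m ∈ blockMaxima n → IsBlockMax m
∈-blockMaxima⁻ {n} m∈ = proj₂ (∈-filter⁻ isBlockMax? {xs = vectors (allFin n) n} m∈)

blockMaxima⁺ : ∀ n → Unique (blockMaxima n)
blockMaxima⁺ n = Unique.filter⁺ isBlockMax? (vectors⁺ (allFin⁺ n) n)

lookup-ext : ∀ {l} (u v : Vec A l) → (∀ i → Vec.lookup u i ≡ Vec.lookup v i) → u ≡ v
lookup-ext u v eq =
  trans (sym (tabulate∘lookup u)) (trans (tabulate-cong eq) (tabulate∘lookup v))

toList-surjective : ∀ {l} (w : List A) → length w ≡ l → ∃ λ (v : Vec A l) → toList v ≡ w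
toList-surjective w refl = Vec.fromList w , toList∘fromList w

toList-injective′ : ∀ {l} (u v : Vec A l) → toList u ≡ toList v → u ≡ v
toList-injective′ u v eq = trans (sym (cast-is-id refl u)) (toList-injective refl u v eq)

∈-avoiders⁺ : {π : Vec (Fin n) n} → VecUnique π → ¬ Contains π pattern23-1→2 →
              π ∈ avoiders n pattern23-1→2
∈-avoiders⁺ {π = π} π! avoids = ∈-filter⁺ (λ π → ¬? (contains? π pattern23-1→2))
  (∈-filter⁺ unique? (∈-vectors ∈-allFin π) π!) avoids

∈-avoiders⁻ : {π : Vec (Fin n) n} → π ∈ avoiders n pattern23-1→2 →
              VecUnique π × ¬ Contains π pattern23-1→2
∈-avoiders⁻ {n} π∈ with ∈-filter⁻ (λ π → ¬? (contains? π pattern23-1→2)) {xs = permutations n} π∈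
... | π∈perms , avoids = proj₂ (∈-filter⁻ unique? {xs = vectors (allFin n) n} π∈perms) , avoids

avoiders⁺ : ∀ n → Unique (avoiders n pattern23-1→2)
avoiders⁺ n = Unique.filter⁺ (λ π → ¬? (contains? π pattern23-1→2))
  (Unique.filter⁺ unique? (vectors⁺ (allFin⁺ n) n))

-- Avoiders and block-maximum functions

module _ {k : ℕ} where

  private
    N = suc k
    p = pattern23-1→2

    _~_ : Vec (Fin N) N → Vec (Fin N) N → Set
    π ~ m = SuffixMax (Vec.lookup m) (toList π)

  avoider-sorted : ∀ {π m} → VecUnique π → ¬ Contains π p → π ~ m →
                   AllPairs (Order._≺_ (Vec.lookup m)) (toList π)
  avoider-sorted {π} {m} π! avoids sm = undominated⇒sorted m (unique-toList π!)
    (avoids⇒undominated π! avoids) sm (unique⇒complete π! (fromℕ k))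

  avoider-blockMax : ∀ {π} → VecUnique π → ∃ λ m → IsBlockMax m × π ~ m
  avoider-blockMax {π} π! with suffixMax (unique-toList π!)
  ... | m , sm = Vec.tabulate m , (λ i → suffixMax-≥ sm′ (unique⇒complete π! i)
                                       , suffixMax-idempotent sm′ (unique⇒complete π! i)) , sm′
    where
    sm′ : π ~ Vec.tabulate m
    sm′ = SuffixMax-cong (All.tabulate λ {i} _ → sym (lookup∘tabulate m i)) sm

  blockMax-avoider : ∀ {m} → IsBlockMax m →
                     ∃ λ π → VecUnique π × ¬ Contains π p × π ~ m
  blockMax-avoider {m} bm = fromWord (sortedWord infl idem)
    where
    open Order (Vec.lookup m)
    infl = proj₁ ∘ bm
    idem = proj₂ ∘ bm
    -- With `w` a variable the equation can be matched with `refl`, so the facts about the sorted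
    -- word hold of `toList π` itself.
    fromVec : ∀ {w} → AllPairs _≺_ w → (∃ λ (π : Vec (Fin N) N) → toList π ≡ w) →
              ∃ λ π → VecUnique π × ¬ Contains π p × π ~ m
    fromVec sorted (π , refl) = π , π! , undominated⇒avoids π! (shape⇒undominated shape) , sm
      where
      π! : VecUnique π
      π! = unique-toList⁻ π (AllPairs.map (λ { i≺i refl → ≺-irrefl i≺i }) sorted)
      closed : ∀ {i} → i ∈ toList π → Vec.lookup m i ∈ toList π
      closed _ = unique⇒complete π! _
      sm : π ~ m
      sm = sorted⇒suffixMax infl idem sorted closed
      shape : Shape (toList π)
      shape = sorted⇒shape infl idem sorted closed sm (unique⇒complete π! (fromℕ k))
    fromWord : (∃ λ w → AllPairs _≺_ w × w ↭ allFin N) →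
               ∃ λ π → VecUnique π × ¬ Contains π p × π ~ m
    fromWord (w , sorted , w↭) =
      fromVec sorted (toList-surjective w (trans (↭-length w↭) (length-tabulate id)))

  -- An avoider contains every letter, so its suffix maxima fix `m` everywhere. Conversely, two
  -- avoiders with the same `m` are both [n] sorted by the same strict order.
  length-avoiders : length (avoiders N p) ≡ length (blockMaxima N)
  length-avoiders = bijective⇒length-≡ _~_ (avoiders⁺ N) (blockMaxima⁺ N)
    (λ π∈ → let m , bm , sm = avoider-blockMax (proj₁ (∈-avoiders⁻ π∈))
            in m , ∈-blockMaxima {m = m} bm , sm)
    (λ {m} m∈ → let π , π! , avoids , sm = blockMax-avoider {m = m} (∈-blockMaxima⁻ m∈)
            in π , ∈-avoiders⁺ π! avoids , sm)
    (λ {_} {m} {m′} π∈ _ _ → functional {m = m} {m′} (∈-avoiders⁻ π∈))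
    (λ {_} {_} {m} π∈ π′∈ → injective {m = m} (∈-avoiders⁻ π∈) (∈-avoiders⁻ π′∈))
    where
    functional : ∀ {π m m′} → VecUnique π × ¬ Contains π p → π ~ m → π ~ m′ → m ≡ m′
    functional {m = m} {m′} (π! , _) sm sm′ = lookup-ext m m′ λ i →
      SuffixMax-functional sm sm′ (unique⇒complete π! i)
    injective : ∀ {π π′ m} → VecUnique π × ¬ Contains π p → VecUnique π′ × ¬ Contains π′ p →
                π ~ m → π′ ~ m → π ≡ π′
    injective {π} {π′} {m} (π! , avoids) (π′! , avoids′) sm sm′ = toList-injective′ π π′
      (sorted-unique (Order.≺-asym (Vec.lookup m)) (avoider-sorted {m = m} π! avoids sm)
        (avoider-sorted {m = m} π′! avoids′ sm′)
        (λ _ → unique⇒complete π′! _) (λ _ → unique⇒complete π! _))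

-- Set partitions

sublists-split : ∀ {x : A} {as} xs → as ∈ sublists (x ∷ xs) →
                 (∃ λ as′ → as′ ∈ sublists xs × as ≡ x ∷ as′) ⊎ as ∈ sublists xs
sublists-split {x = x} xs as∈ with ∈-++⁻ (map (x ∷_) (sublists xs)) as∈
... | inj₁ p = inj₁ (∈-map⁻ (x ∷_) p)
... | inj₂ q = inj₂ q

∈-sublists⇒⊆ : ∀ {x : A} {as} xs → as ∈ sublists xs → x ∈ as → x ∈ xs
∈-sublists⇒⊆ [] (here refl) ()
∈-sublists⇒⊆ (y ∷ xs) as∈ x∈as with sublists-split xs as∈
... | inj₂ as∈′ = there (∈-sublists⇒⊆ xs as∈′ x∈as)
... | inj₁ (as′ , as′∈ , refl) with x∈as
... | here x≡y     = here x≡y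
... | there x∈as′ = there (∈-sublists⇒⊆ xs as′∈ x∈as′)

sublists⁺ : {xs : List A} → Unique xs → Unique (sublists xs)
sublists⁺ [] = [] ∷ []
sublists⁺ {xs = x ∷ xs} xs!@(_ ∷ xs!′) =
  Unique.++⁺ (Unique.map⁺ List.∷-injectiveʳ (sublists⁺ xs!′)) (sublists⁺ xs!′) disjoint
  where
  disjoint : ∀ {as} → ¬ (as ∈ map (x ∷_) (sublists xs) × as ∈ sublists xs)
  disjoint (p , q) with ∈-map⁻ (x ∷_) p
  ... | _ , _ , refl = unique⇒∉ xs! (∈-sublists⇒⊆ xs q (here refl))

-- In a repetition-free list, whether a sublist takes the head can be read off from its members.
-- Partitions counted by `bell` can therefore be compared block by block.
sublists-ext : {xs as bs : List A} → Unique xs → as ∈ sublists xs → bs ∈ sublists xs →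
               (∀ {x} → x ∈ as → x ∈ bs) → (∀ {x} → x ∈ bs → x ∈ as) → as ≡ bs
sublists-ext [] (here refl) (here refl) _ _ = refl
sublists-ext {xs = x ∷ xs} xs!@(_ ∷ xs!′) as∈ bs∈ f g
  with sublists-split xs as∈ | sublists-split xs bs∈
... | inj₂ as∈′ | inj₂ bs∈′ = sublists-ext xs!′ as∈′ bs∈′ f g
... | inj₁ (_ , _ , refl) | inj₂ bs∈′ =
  contradiction (∈-sublists⇒⊆ xs bs∈′ (f (here refl))) (unique⇒∉ xs!)
... | inj₂ as∈′ | inj₁ (_ , _ , refl) =
  contradiction (∈-sublists⇒⊆ xs as∈′ (g (here refl))) (unique⇒∉ xs!)
... | inj₁ (_ , as∈′ , refl) | inj₁ (_ , bs∈′ , refl) =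
  cong (x ∷_) (sublists-ext xs!′ as∈′ bs∈′
    (λ p → ∈-tail (f (there p)) λ { refl → unique⇒∉ xs! (∈-sublists⇒⊆ xs as∈′ p) })
    (λ p → ∈-tail (g (there p)) λ { refl → unique⇒∉ xs! (∈-sublists⇒⊆ xs bs∈′ p) }))

filter∈sublists : {P : A → Set} (P? : ∀ x → Dec (P x)) (xs : List A) → filter P? xs ∈ sublists xs
filter∈sublists P? [] = here refl
filter∈sublists P? (x ∷ xs) with does (P? x)
... | true  = ∈-++⁺ˡ (∈-map⁺ (x ∷_) (filter∈sublists P? xs))
... | false = ∈-++⁺ʳ (map (x ∷_) (sublists xs)) (filter∈sublists P? xs)

unique⇒allPairs : {R : A → A → Set} {xs : List A} → Unique xs →
                  (∀ {x y} → x ∈ xs → y ∈ xs → x ≢ y → R x y) → AllPairs R xs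
unique⇒allPairs [] _ = []
unique⇒allPairs (x≢ ∷ xs!) r =
  All.tabulate (λ y∈ → r (here refl) (there y∈) (All.lookup x≢ y∈))
  ∷ unique⇒allPairs xs! (λ p q → r (there p) (there q))

disjoint⇒≡ : {bs : List (Subset n)} → AllPairs Disjoint bs → ∀ {p q} → p ∈ bs → q ∈ bs →
             i ∈ˢ p → i ∈ˢ q → p ≡ q
disjoint⇒≡ _ (here refl) (here refl) _ _ = refl
disjoint⇒≡ (d ∷ _) (here refl) (there q∈) i∈p i∈q =
  contradiction (_ , x∈p∩q⁺ (i∈p , i∈q)) (All.lookup d q∈)
disjoint⇒≡ (d ∷ _) (there p∈) (here refl) i∈p i∈q =
  contradiction (_ , x∈p∩q⁺ (i∈q , i∈p)) (All.lookup d p∈)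
disjoint⇒≡ (_ ∷ ds) (there p∈) (there q∈) i∈p i∈q = disjoint⇒≡ ds p∈ q∈ i∈p i∈q

subset-maximum : (p : Subset n) → i ∈ˢ p → ∃ λ M → M ∈ˢ p × (∀ {j} → j ∈ˢ p → j ≤ M)
subset-maximum {n} {i} p i∈p = fromWord (filter (_∈ˢ? p) (allFin n)) refl
  where
  -- A variable `w` allows the case split, while the equation keeps its link to `p`.
  fromWord : ∀ w → w ≡ filter (_∈ˢ? p) (allFin n) → ∃ λ M → M ∈ˢ p × (∀ {j} → j ∈ˢ p → j ≤ M)
  fromWord [] eq with subst (i ∈_) (sym eq) (∈-filter⁺ (_∈ˢ? p) (∈-allFin i) i∈p)
  ... | ()
  fromWord (x ∷ w) eq with maximum x w
  ... | M , M∈ , ≤M = M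
    , proj₂ (∈-filter⁻ (_∈ˢ? p) {xs = allFin n} (subst (M ∈_) eq M∈))
    , λ {j} j∈p → All.lookup ≤M (subst (j ∈_) (sym eq) (∈-filter⁺ (_∈ˢ? p) (∈-allFin j) j∈p))

fiber : (Fin n → Fin n) → Fin n → Subset n
fiber m M = Vec.tabulate λ j → does (m j ≟ M)

∈-fiber⁺ : m j ≡ M → j ∈ˢ fiber m M
∈-fiber⁺ {m = m} {j = j} {M = M} eq =
  lookup⇒[]= j _ (trans (lookup∘tabulate _ j) (dec-true (m j ≟ M) eq))

∈-fiber⁻ : j ∈ˢ fiber m M → m j ≡ M
∈-fiber⁻ {j = j} {m = m} {M = M} j∈ with m j ≟ M | trans (sym (lookup∘tabulate _ j)) ([]=⇒lookup j∈)
... | yes eq | _  = eq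
... | no _   | ()

subsets : (n : ℕ) → List (Subset n)
subsets n = vectors (inside ∷ outside ∷ []) n

subsets⁺ : ∀ n → Unique (subsets n)
subsets⁺ = vectors⁺ (((λ ()) ∷ []) ∷ [] ∷ [])

∈-subsets : (p : Subset n) → p ∈ subsets n
∈-subsets = ∈-vectors λ { true → here refl ; false → there (here refl) }

infix 4 _FibredBy_
-- Fibres are taken only over values `m i`, so each contains `i` and is a nonempty block.
_FibredBy_ : List (Subset n) → Vec (Fin n) n → Set
bs FibredBy m = (∀ {b} → b ∈ bs → ∃ λ i → b ≡ fiber (Vec.lookup m) (Vec.lookup m i))
              × (∀ i → fiber (Vec.lookup m) (Vec.lookup m i) ∈ bs)

-- The blocks are filtered from the list of all subsets, which makes `bs` one of the sublists
-- enumerated by `setPartitions`.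
fibers-partition : (m : Vec (Fin n) n) → ∃ λ bs → bs ∈ setPartitions n × bs FibredBy m
fibers-partition {n} m = bs , ∈-filter⁺ isSetPartition? bs∈ (nonempty , disjoint , covering) , fib
  where
  f = Vec.lookup m
  isFiber? : (b : Subset n) → Dec (∃ λ i → b ≡ fiber f (f i))
  isFiber? b = any? λ i → ≡-dec Bool._≟_ b (fiber f (f i))
  bs = filter isFiber? (subsets n)
  bs∈ : bs ∈ sublists (subsets n)
  bs∈ = filter∈sublists isFiber? (subsets n)
  fib : bs FibredBy m
  fib = (λ b∈ → proj₂ (∈-filter⁻ isFiber? {xs = subsets n} b∈))
      , (λ i → ∈-filter⁺ isFiber? (∈-subsets _) (i , refl))
  nonempty : All Nonempty bs
  nonempty = All.tabulate λ b∈ → let i , b≡ = proj₁ fib b∈ in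
    i , subst (i ∈ˢ_) (sym b≡) (∈-fiber⁺ {m = f} refl)
  disjoint : AllPairs Disjoint bs
  disjoint = unique⇒allPairs (Unique.filter⁺ isFiber? (subsets⁺ n)) separate
    where
    separate : ∀ {p q} → p ∈ bs → q ∈ bs → p ≢ q → Disjoint p q
    separate {p} {q} p∈ q∈ p≢q (l , l∈) with proj₁ fib p∈ | proj₁ fib q∈ | x∈p∩q⁻ p q l∈
    ... | i , refl | j , refl | l∈p , l∈q =
      p≢q (cong (fiber f) (trans (sym (∈-fiber⁻ {m = f} l∈p)) (∈-fiber⁻ {m = f} l∈q)))
  covering : ∀ i → Any (i ∈ˢ_) bs
  covering i = lose (proj₂ fib i) (∈-fiber⁺ {m = f} refl)

partition-fibers : {bs : List (Subset n)} → IsSetPartition bs → ∃ λ m → IsBlockMax m × bs FibredBy m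
partition-fibers {n} {bs} (nonempty , disjoint , covering) =
  maxima , (λ i → ≤max (block∈ i) (∈block i) (∈block i) , idempotent i)
    , (λ b∈ → let i , i∈b = All.lookup nonempty b∈ in i , block≡fiber b∈ i∈b)
    , (λ i → subst (_∈ bs) (block≡fiber (block∈ i) (∈block i)) (block∈ i))
  where
  block : Fin n → Subset n
  block i = proj₁ (find (covering i))
  block∈ : ∀ i → block i ∈ bs
  block∈ i = proj₁ (proj₂ (find (covering i)))
  ∈block : ∀ i → i ∈ˢ block i
  ∈block i = proj₂ (proj₂ (find (covering i)))
  blockMax : ∀ i → ∃ λ M → M ∈ˢ block i × (∀ {j} → j ∈ˢ block i → j ≤ M)
  blockMax i = subset-maximum (block i) (∈block i)
  maxima : Vec (Fin n) n
  maxima = Vec.tabulate (proj₁ ∘ blockMax)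
  f = Vec.lookup maxima
  -- `block i` is whichever block the covering finds; disjointness identifies it with `b`.
  max∈ : ∀ {b i} → b ∈ bs → i ∈ˢ b → f i ∈ˢ b
  max∈ {b} {i} b∈ i∈b rewrite lookup∘tabulate (proj₁ ∘ blockMax) i =
    subst (_ ∈ˢ_) (disjoint⇒≡ disjoint (block∈ i) b∈ (∈block i) i∈b) (proj₁ (proj₂ (blockMax i)))
  ≤max : ∀ {b i j} → b ∈ bs → i ∈ˢ b → j ∈ˢ b → j ≤ f i
  ≤max {b} {i} {j} b∈ i∈b j∈b rewrite lookup∘tabulate (proj₁ ∘ blockMax) i =
    proj₂ (proj₂ (blockMax i))
      (subst (j ∈ˢ_) (sym (disjoint⇒≡ disjoint (block∈ i) b∈ (∈block i) i∈b)) j∈b)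
  same-max : ∀ {b i j} → b ∈ bs → i ∈ˢ b → j ∈ˢ b → f i ≡ f j
  same-max b∈ i∈b j∈b =
    ≤-antisym (≤max b∈ j∈b (max∈ b∈ i∈b)) (≤max b∈ i∈b (max∈ b∈ j∈b))
  idempotent : ∀ i → f (f i) ≡ f i
  idempotent i = same-max (block∈ i) (max∈ (block∈ i) (∈block i)) (∈block i)
  block≡fiber : ∀ {b i} → b ∈ bs → i ∈ˢ b → b ≡ fiber f (f i)
  block≡fiber {b} {i} b∈ i∈b = ⊆-antisym
    (λ j∈b → ∈-fiber⁺ {m = f} (same-max b∈ j∈b i∈b))
    -- The common maximum lies in the blocks of both `i` and `j`, so these blocks coincide.
    (λ {j} j∈fiber → let fj≡fi = ∈-fiber⁻ {m = f} j∈fiber in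
      subst (j ∈ˢ_)
        (disjoint⇒≡ disjoint (block∈ j) b∈
          (max∈ (block∈ j) (∈block j)) (subst (_∈ˢ b) (sym fj≡fi) (max∈ b∈ i∈b)))
        (∈block j))

-- The fibre of `m` through `i` contains `m i` and is also a fibre of `m′`. So `m′` takes the same
-- value at `i` and at `m i`, and that value is at least `m i`. Exchanging `m` and `m′` gives
-- equality.
fibers-≤ : ∀ {bs} {m m′ : Vec (Fin n) n} → IsBlockMax m → IsBlockMax m′ →
           bs FibredBy m → bs FibredBy m′ → ∀ i → Vec.lookup m i ≤ Vec.lookup m′ i
fibers-≤ {m = m} {m′} bm bm′ (_ , fiber∈) (fibers′ , _) i with fibers′ (fiber∈ i)
... | j , eq = subst (Vec.lookup m i ≤_) (trans (same (proj₂ (bm i))) (sym (same refl)))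
                     (proj₁ (bm′ (Vec.lookup m i)))
  where
  same : ∀ {l} → Vec.lookup m l ≡ Vec.lookup m i → Vec.lookup m′ l ≡ Vec.lookup m′ j
  same {l} p = ∈-fiber⁻ {m = Vec.lookup m′} (subst (l ∈ˢ_) eq (∈-fiber⁺ {m = Vec.lookup m} p))

length-blockMaxima : ∀ n → length (blockMaxima n) ≡ bell n
length-blockMaxima n = bijective⇒length-≡ (λ m bs → bs FibredBy m)
  (blockMaxima⁺ n) (Unique.filter⁺ isSetPartition? (sublists⁺ (subsets⁺ n)))
  (λ {m} _ → fibers-partition m)
  (λ bs∈ → let m , bm , fib = partition-fibers (proj₂ (split bs∈))
           in m , ∈-blockMaxima {m = m} bm , fib)
  (λ {m} _ bs∈ bs′∈ → functional {m} (proj₁ (split bs∈)) (proj₁ (split bs′∈)))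
  (λ {m} {m′} m∈ m′∈ fib fib′ →
    let bm = ∈-blockMaxima⁻ {m = m} m∈ ; bm′ = ∈-blockMaxima⁻ {m = m′} m′∈ in
    lookup-ext m m′ λ i → ≤-antisym (fibers-≤ {m = m} {m′} bm bm′ fib fib′ i)
                                    (fibers-≤ {m = m′} {m} bm′ bm fib′ fib i))
  where
  split : ∀ {bs} → bs ∈ setPartitions n → bs ∈ sublists (subsets n) × IsSetPartition bs
  split = ∈-filter⁻ isSetPartition? {xs = sublists (subsets n)}
  functional : ∀ {m bs bs′} → bs ∈ sublists (subsets n) → bs′ ∈ sublists (subsets n) →
               bs FibredBy m → bs′ FibredBy m → bs ≡ bs′
  functional bs∈ bs′∈ (fibers , fiber∈) (fibers′ , fiber∈′) = sublists-ext (subsets⁺ n) bs∈ bs′∈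
    (λ b∈ → let i , b≡ = fibers b∈ in subst (_∈ _) (sym b≡) (fiber∈′ i))
    (λ b∈ → let i , b≡ = fibers′ b∈ in subst (_∈ _) (sym b≡) (fiber∈ i))

theorem5p2 : (n : ℕ) → n ≥ 1 → length (avoiders n pattern23-1→2) ≡ bell n
theorem5p2 (suc k) _ = trans (length-avoiders {k}) (length-blockMaxima (suc k))
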